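{- Let $a,b$ be positive integers and let $\{F_n(q)\}_{n\geq 0}$ be the $q$-biperiodic Fibonacci sequence. For every integer $n\geq 0$, $$F_{2n+2}(q)=a\sum_{i=0}^n\sum_{j=0}^n(ab)^{\xi(n-i-j)}q^{i^2+(n+i+1)j} {n-j\brack i}{n-i\brack j}(ab)^{2\left\lfloor \frac{n-i-j}{2} \right\rfloor}.$$
   Context: Fix positive integers $a,b$; $q$ is an indeterminate. For an integer $n$, $\xi(n)=n-2\lfloor n/2\rfloor$ (so $\xi(n)=0$ if $n$ is even and $1$ if $n$ is odd). The $q$-biperiodic Fibonacci sequence is defined by $F_0(q)=0$, $F_1(q)=1$ and, for $n\geq 2$, $F_n(q)=aF_{n-1}(q)+q^{n-2}F_{n-2}(q)$ if $n$ is even, $F_n(q)=bF_{n-1}(q)+q^{n-2}F_{n-2}(q)$ if $n$ is odd. The $q$-binomial coefficient is ${n\brack k}=\frac{[n]_q!}{[k]_q!\,[n-k]_q!}$ for $0\leq k\leq n$ and ${n\brack k}=0$ for $k<0$ or $k>n\geq 0$, where $[n]_q=1+q+\cdots+q^{n-1}$ and $[n]_q!=[1]_q[2]_q\cdots[n]_q$, $[0]_q!=1$. Terms with a vanishing $q$-binomial coefficient are zero (even if the exponent of $ab$ is negative). -}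

module Defs where

open import Algebra.Bundles.Raw using (RawSemiring)
import Algebra.Definitions.RawSemiring as RawSemiringDefs
open import Data.Bool.Base using (if_then_else_)
open import Data.Fin.Base using (toℕ)
open import Data.Integer.Base as ℤ using (ℤ; +_; -[1+_]; 0ℤ; 1ℤ; _/ℕ_)
import Data.Integer.Properties as ℤ
open import Data.List.Base using (List; []; _∷_; replicate)
import Data.List.Base as List
open import Data.Nat.Base as ℕ using (ℕ; zero; suc; NonZero; _∸_)
open import Data.Nat.Divisibility using (_∣?_)
import Data.Nat.Properties as ℕ
open import Data.Sum.Base as Sum using (_⊎_; inj₁; inj₂; [_,_]′)
open import Level using (0ℓ)
open import Relation.Binary.PropositionalEquality
open import Relation.Nullary using (¬_; does; yes; no)

-- ℤ[q]: coefficient lists, constant coefficient first.  Trailing zeros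
-- are allowed, so polynomials are compared coefficient by coefficient.

ℤ[q] : Set
ℤ[q] = List ℤ

coeff : ℤ[q] → ℕ → ℤ
coeff []       k       = 0ℤ
coeff (c ∷ cs) zero    = c
coeff (c ∷ cs) (suc k) = coeff cs k

infix 4 _≈ᵖ_ _≉ᵖ_

record _≈ᵖ_ (p r : ℤ[q]) : Set where
  constructor mk≈
  field coeff-≡ : ∀ k → coeff p k ≡ coeff r k

open _≈ᵖ_ public

_≉ᵖ_ : ℤ[q] → ℤ[q] → Set
p ≉ᵖ r = ¬ p ≈ᵖ r

infixl 6 _+ᵖ_
infixl 7 _*ᵖ_ _·ᵖ_

_+ᵖ_ : ℤ[q] → ℤ[q] → ℤ[q]
[]      +ᵖ r       = r
(c ∷ p) +ᵖ []      = c ∷ p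
(c ∷ p) +ᵖ (d ∷ r) = (c ℤ.+ d) ∷ (p +ᵖ r)

_·ᵖ_ : ℤ → ℤ[q] → ℤ[q]
c ·ᵖ p = List.map (c ℤ.*_) p

-- (c + q p) r = c r + q (p r)
_*ᵖ_ : ℤ[q] → ℤ[q] → ℤ[q]
[]      *ᵖ r = []
(c ∷ p) *ᵖ r = (c ·ᵖ r) +ᵖ (0ℤ ∷ (p *ᵖ r))

const : ℕ → ℤ[q]
const m = + m ∷ []

0ᵖ 1ᵖ q : ℤ[q]
0ᵖ = []
1ᵖ = const 1
q  = 0ℤ ∷ 1ℤ ∷ []

ℤ[q]-rawSemiring : RawSemiring 0ℓ 0ℓ
ℤ[q]-rawSemiring = record
  { Carrier = ℤ[q]
  ; _≈_     = _≈ᵖ_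
  ; _+_     = _+ᵖ_
  ; _*_     = _*ᵖ_
  ; 0#      = 0ᵖ
  ; 1#      = 1ᵖ
  }

open RawSemiringDefs ℤ[q]-rawSemiring public
  using () renaming (_^_ to infixr 8 _^ᵖ_)

-- ℤ[q] has no zero divisors, so fractions can be added and multiplied.

coeff-+ᵖ : ∀ p r k → coeff (p +ᵖ r) k ≡ coeff p k ℤ.+ coeff r k
coeff-+ᵖ []      r       k       = sym (ℤ.+-identityˡ (coeff r k))
coeff-+ᵖ (c ∷ p) []      k       = sym (ℤ.+-identityʳ (coeff (c ∷ p) k))
coeff-+ᵖ (c ∷ p) (d ∷ r) zero    = refl
coeff-+ᵖ (c ∷ p) (d ∷ r) (suc k) = coeff-+ᵖ p r k

coeff-·ᵖ : ∀ c p k → coeff (c ·ᵖ p) k ≡ c ℤ.* coeff p k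
coeff-·ᵖ c []      k       = sym (ℤ.*-zeroʳ c)
coeff-·ᵖ c (d ∷ p) zero    = refl
coeff-·ᵖ c (d ∷ p) (suc k) = coeff-·ᵖ c p k

private
  head-*ᵖ : ∀ c p d r → coeff ((c ∷ p) *ᵖ (d ∷ r)) 0 ≡ c ℤ.* d
  head-*ᵖ c p d r = ℤ.+-identityʳ (c ℤ.* d)

  0∷*ᵖ : ∀ {c} → c ≡ 0ℤ → ∀ p r k → coeff ((c ∷ p) *ᵖ r) (suc k) ≡ coeff (p *ᵖ r) k
  0∷*ᵖ refl p r k = begin
    coeff ((0ℤ ·ᵖ r) +ᵖ (0ℤ ∷ (p *ᵖ r))) (suc k)
      ≡⟨ coeff-+ᵖ (0ℤ ·ᵖ r) (0ℤ ∷ (p *ᵖ r)) (suc k) ⟩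
    coeff (0ℤ ·ᵖ r) (suc k) ℤ.+ coeff (p *ᵖ r) k
      ≡⟨ cong (ℤ._+ coeff (p *ᵖ r) k) (coeff-·ᵖ 0ℤ r (suc k)) ⟩
    0ℤ ℤ.+ coeff (p *ᵖ r) k
      ≡⟨ ℤ.+-identityˡ _ ⟩
    coeff (p *ᵖ r) k ∎
    where open ≡-Reasoning

  *ᵖ0∷ : ∀ {d} → d ≡ 0ℤ → ∀ p r k → coeff (p *ᵖ (d ∷ r)) (suc k) ≡ coeff (p *ᵖ r) k
  *ᵖ0∷ refl []      r k = refl
  *ᵖ0∷ refl (c ∷ p) r k = begin
    coeff ((c ·ᵖ r) +ᵖ (p *ᵖ (0ℤ ∷ r))) k
      ≡⟨ coeff-+ᵖ (c ·ᵖ r) (p *ᵖ (0ℤ ∷ r)) k ⟩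
    coeff (c ·ᵖ r) k ℤ.+ coeff (p *ᵖ (0ℤ ∷ r)) k
      ≡⟨ cong (λ x → coeff (c ·ᵖ r) k ℤ.+ x) (shift k) ⟩
    coeff (c ·ᵖ r) k ℤ.+ coeff (0ℤ ∷ (p *ᵖ r)) k
      ≡⟨ coeff-+ᵖ (c ·ᵖ r) (0ℤ ∷ (p *ᵖ r)) k ⟨
    coeff ((c ·ᵖ r) +ᵖ (0ℤ ∷ (p *ᵖ r))) k ∎
    where
    open ≡-Reasoning
    const-0 : ∀ p → coeff (p *ᵖ (0ℤ ∷ r)) 0 ≡ 0ℤ
    const-0 []      = refl
    const-0 (d ∷ p) = trans (head-*ᵖ d p 0ℤ r) (ℤ.*-zeroʳ d)
    shift : ∀ k → coeff (p *ᵖ (0ℤ ∷ r)) k ≡ coeff (0ℤ ∷ (p *ᵖ r)) k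
    shift zero    = const-0 p
    shift (suc k) = *ᵖ0∷ refl p r k

  ∷≈0 : ∀ {c p} → c ≡ 0ℤ → p ≈ᵖ 0ᵖ → c ∷ p ≈ᵖ 0ᵖ
  ∷≈0 c≡0 p≈0 .coeff-≡ zero    = c≡0
  ∷≈0 c≡0 p≈0 .coeff-≡ (suc k) = p≈0 .coeff-≡ k

*ᵖ≈0⇒≈0⊎≈0 : ∀ p r → p *ᵖ r ≈ᵖ 0ᵖ → p ≈ᵖ 0ᵖ ⊎ r ≈ᵖ 0ᵖ
*ᵖ≈0⇒≈0⊎≈0 []      r       _   = inj₁ (mk≈ λ _ → refl)
*ᵖ≈0⇒≈0⊎≈0 (c ∷ p) []      _   = inj₂ (mk≈ λ _ → refl)
*ᵖ≈0⇒≈0⊎≈0 (c ∷ p) (d ∷ r) pr≈0 = [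
  (λ c≡0 → Sum.map₁ (∷≈0 c≡0) (*ᵖ≈0⇒≈0⊎≈0 p (d ∷ r) (mk≈ λ k →
    trans (sym (0∷*ᵖ c≡0 p (d ∷ r) k)) (pr≈0 .coeff-≡ (suc k))))) ,
  (λ d≡0 → Sum.map₂ (∷≈0 d≡0) (*ᵖ≈0⇒≈0⊎≈0 (c ∷ p) r (mk≈ λ k →
    trans (sym (*ᵖ0∷ d≡0 (c ∷ p) r k)) (pr≈0 .coeff-≡ (suc k))))) ]′
  (ℤ.i*j≡0⇒i≡0∨j≡0 c (trans (sym (head-*ᵖ c p d r)) (pr≈0 .coeff-≡ 0)))

*ᵖ-≉0 : ∀ {p r} → p ≉ᵖ 0ᵖ → r ≉ᵖ 0ᵖ → p *ᵖ r ≉ᵖ 0ᵖ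
*ᵖ-≉0 p≉0 r≉0 pr≈0 = [ p≉0 , r≉0 ]′ (*ᵖ≈0⇒≈0⊎≈0 _ _ pr≈0)

1ᵖ≉0 : 1ᵖ ≉ᵖ 0ᵖ
1ᵖ≉0 1≈0 with () ← 1≈0 .coeff-≡ 0

const≉0 : ∀ m .{{_ : NonZero m}} → const m ≉ᵖ 0ᵖ
const≉0 (suc m) m≈0 with () ← m≈0 .coeff-≡ 0

-- Elements of ℚ(q), the field of fractions of ℤ[q].  Fractions are not
-- reduced, so they are compared by cross-multiplication.

record ℚ⟨q⟩ : Set where
  constructor mkFrac
  field
    num   : ℤ[q]
    den   : ℤ[q]
    den≉0 : den ≉ᵖ 0ᵖ

open ℚ⟨q⟩ public

infix  4 _≃_
infixl 6 _+ᶠ_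
infixl 7 _*ᶠ_

record _≃_ (x y : ℚ⟨q⟩) : Set where
  constructor mk≃
  field cross-≈ : num x *ᵖ den y ≈ᵖ num y *ᵖ den x

open _≃_ public

_+ᶠ_ _*ᶠ_ : ℚ⟨q⟩ → ℚ⟨q⟩ → ℚ⟨q⟩
mkFrac p d d≉0 +ᶠ mkFrac r e e≉0 =
  mkFrac (p *ᵖ e +ᵖ r *ᵖ d) (d *ᵖ e) (*ᵖ-≉0 d≉0 e≉0)
mkFrac p d d≉0 *ᶠ mkFrac r e e≉0 =
  mkFrac (p *ᵖ r) (d *ᵖ e) (*ᵖ-≉0 d≉0 e≉0)

ι : ℤ[q] → ℚ⟨q⟩
ι p = mkFrac p 1ᵖ 1ᵖ≉0

ℚ⟨q⟩-rawSemiring : RawSemiring 0ℓ 0ℓ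
ℚ⟨q⟩-rawSemiring = record
  { Carrier = ℚ⟨q⟩
  ; _≈_     = _≃_
  ; _+_     = _+ᶠ_
  ; _*_     = _*ᶠ_
  ; 0#      = ι 0ᵖ
  ; 1#      = ι 1ᵖ
  }

∑≤ : ℕ → (ℕ → ℚ⟨q⟩) → ℚ⟨q⟩
∑≤ n f = RawSemiringDefs.sum ℚ⟨q⟩-rawSemiring {suc n} (λ i → f (toℕ i))

infixl 6 ∑≤
syntax ∑≤ n (λ i → x) = ∑[ i ≤ n ] x

infixr 8 _^ᶻ_

_^ᶻ_ : (m : ℕ) .{{_ : NonZero m}} → ℤ → ℚ⟨q⟩
m ^ᶻ (+ k)    = ι (const (m ℕ.^ k))
m ^ᶻ -[1+ k ] = mkFrac 1ᵖ (const (m ℕ.^ suc k))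
                  (const≉0 (m ℕ.^ suc k) {{ℕ.m^n≢0 m (suc k)}})

-- [ n ]q = 1 + q + ⋯ + qⁿ⁻¹
[_]q : ℕ → ℤ[q]
[ n ]q = replicate n 1ℤ

[_]q! : ℕ → ℤ[q]
[ zero  ]q! = 1ᵖ
[ suc n ]q! = [ n ]q! *ᵖ [ suc n ]q

[n]q!≉0 : ∀ n → [ n ]q! ≉ᵖ 0ᵖ
[n]q!≉0 zero    = 1ᵖ≉0
[n]q!≉0 (suc n) = *ᵖ-≉0 ([n]q!≉0 n) [1+n]q≉0
  where
  [1+n]q≉0 : [ suc n ]q ≉ᵖ 0ᵖ
  [1+n]q≉0 eq with () ← eq .coeff-≡ 0

qbinom : ℕ → ℕ → ℚ⟨q⟩
qbinom n k with k ℕ.≤? n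
... | yes _ = mkFrac [ n ]q! ([ k ]q! *ᵖ [ n ∸ k ]q!)
                (*ᵖ-≉0 ([n]q!≉0 k) ([n]q!≉0 (n ∸ k)))
... | no  _ = ι 0ᵖ

-- _/ℕ_ rounds towards -∞.
⌊_/2⌋ : ℤ → ℤ
⌊ m /2⌋ = m /ℕ 2

ξ : ℤ → ℤ
ξ m = m ℤ.- + 2 ℤ.* ⌊ m /2⌋

F : ℕ → ℕ → ℕ → ℤ[q]
F a b zero          = 0ᵖ
F a b (suc zero)    = 1ᵖ
F a b (suc (suc n)) =
  const (if does (2 ∣? suc (suc n)) then a else b) *ᵖ F a b (suc n)
    +ᵖ q ^ᵖ n *ᵖ F a b n

module Submission where

open import Defs
open import Algebra.Bundles using (CommutativeMonoid; CommutativeSemiring)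
import Algebra.Properties.CommutativeSemigroup as CommutativeSemigroupProperties
import Algebra.Properties.Semiring.Exp as Exp
import Algebra.Solver.Ring.NaturalCoefficients.Default as SemiringSolver
open import Algebra.Structures.Biased using (IsCommutativeSemiringˡ)
open import Data.Bool.Base using (if_then_else_)
open import Data.Integer.Base as ℤ using (ℤ; +_; _-_; 0ℤ; 1ℤ)
import Data.Integer.Properties as ℤ
open import Data.List.Base using ([]; _∷_)
open import Data.Nat.Base
  using (ℕ; zero; suc; NonZero; _+_; _*_; _∸_; _^_; _≤_; _<_; z≤n; s≤s; z<s; s<s; _/_; _%_)
open import Data.Nat.Divisibility using (_∣_; _∣?_; divides; ∣m+n∣m⇒∣n; ∣1⇒≡1)
open import Data.Nat.DivMod using (m≡m%n+[m/n]*n)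
open import Data.Nat.Properties as ℕ using (m*n≢0)
open import Data.Nat.Tactic.RingSolver using (solve-∀)
open import Data.Product.Base using (_,_)
open import Level using (0ℓ)
open import Relation.Binary.PropositionalEquality as ≡ using (_≡_)
import Relation.Binary.Reasoning.Setoid as SetoidReasoning
open import Relation.Binary.Structures using (IsEquivalence)
open import Relation.Nullary using (¬_; yes; no; contradiction; does)
open import Relation.Nullary.Decidable using (dec-true; dec-false)

-- A tiling argument with monomers and dominoes gives F_{2n+2}(q) / a as the sum over
-- k + m = n of (ab)^m q^{k²} [2m+1+k choose k]: monomers weigh alternately a and
-- b, and the q-weights satisfy the q-Pascal rule.  The q-Vandermonde identity
-- for 1/(z;q)_{2m+2} = 1/(z;q)_{m+1} · 1/(q^{m+1}z;q)_{m+1} then splits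
-- [2m+1+k choose k] as the sum over i + j = k of q^{j(m+1)} [m+i choose i] [m+j choose j],
-- where m + i = n − j and m + j = n − i.

-- Sums over antidiagonals in a commutative semiring.

module AntidiagonalSum {c ℓ} (R : CommutativeSemiring c ℓ) where
  open CommutativeSemiring R
    renaming (_+_ to _⊕_; _*_ to _⊗_)
  open SetoidReasoning setoid
  open CommutativeSemigroupProperties +-commutativeSemigroup using (interchange)

  -- Both indices are passed to `f`, so that the second one is never a truncated difference.
  antidiag : (ℕ → ℕ → Carrier) → ℕ → Carrier
  antidiag f zero    = f 0 0
  antidiag f (suc n) = f 0 (suc n) ⊕ antidiag (λ i → f (suc i)) n

  antidiag-cong : ∀ {f g} n → (∀ i j → i + j ≡ n → f i j ≈ g i j) →
                  antidiag f n ≈ antidiag g n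
  antidiag-cong zero    f≈g = f≈g 0 0 ≡.refl
  antidiag-cong (suc n) f≈g =
    +-cong (f≈g 0 (suc n) ≡.refl)
           (antidiag-cong n λ i j eq → f≈g (suc i) j (≡.cong suc eq))

  antidiag-0 : ∀ n → antidiag (λ _ _ → 0#) n ≈ 0#
  antidiag-0 zero    = refl
  antidiag-0 (suc n) = trans (+-identityˡ _) (antidiag-0 n)

  antidiag-⊕ : ∀ f g n →
               antidiag (λ i j → f i j ⊕ g i j) n ≈ antidiag f n ⊕ antidiag g n
  antidiag-⊕ f g zero    = refl
  antidiag-⊕ f g (suc n) =
    trans (+-congˡ (antidiag-⊕ (λ i → f (suc i)) (λ i → g (suc i)) n))
          (interchange _ _ _ _)

  antidiag-*ˡ : ∀ x f n → antidiag (λ i j → x ⊗ f i j) n ≈ x ⊗ antidiag f n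
  antidiag-*ˡ x f zero    = refl
  antidiag-*ˡ x f (suc n) =
    trans (+-congˡ (antidiag-*ˡ x (λ i → f (suc i)) n)) (sym (distribˡ x _ _))

  antidiag-last : ∀ f n →
                  antidiag f (suc n) ≈ antidiag (λ i j → f i (suc j)) n ⊕ f (suc n) 0
  antidiag-last f zero    = refl
  antidiag-last f (suc n) =
    trans (+-congˡ (antidiag-last (λ i → f (suc i)) n)) (sym (+-assoc _ _ _))

  antidiag-swap : ∀ f n → antidiag f n ≈ antidiag (λ i j → f j i) n
  antidiag-swap f zero    = refl
  antidiag-swap f (suc n) = begin
    f 0 (suc n) ⊕ antidiag (λ i → f (suc i)) n
      ≈⟨ +-congˡ (antidiag-swap (λ i → f (suc i)) n) ⟩
    f 0 (suc n) ⊕ antidiag (λ i j → f (suc j) i) n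
      ≈⟨ +-comm _ _ ⟩
    antidiag (λ i j → f (suc j) i) n ⊕ f 0 (suc n)
      ≈⟨ antidiag-last (λ i j → f j i) n ⟨
    antidiag (λ i j → f j i) (suc n) ∎

  -- Both sides run over all triples with sum `n`. The triples with `i = 0` are split off on each
  -- side; the others are covered by the induction hypothesis for `f (suc i)`.
  antidiag-assoc : ∀ (f : ℕ → ℕ → ℕ → Carrier) n →
    antidiag (λ i r → antidiag (λ j k → f i j k) r) n ≈
    antidiag (λ r k → antidiag (λ i j → f i j k) r) n
  antidiag-assoc f zero    = refl
  antidiag-assoc f (suc n) = begin
    (f 0 0 (suc n) ⊕ antidiag (λ j k → f 0 (suc j) k) n)
      ⊕ antidiag (λ i r → antidiag (f (suc i)) r) n
      ≈⟨ +-congˡ (antidiag-assoc (λ i → f (suc i)) n) ⟩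
    (f 0 0 (suc n) ⊕ antidiag (λ j k → f 0 (suc j) k) n)
      ⊕ antidiag (λ r k → antidiag (λ i j → f (suc i) j k) r) n
      ≈⟨ +-assoc _ _ _ ⟩
    f 0 0 (suc n) ⊕ (antidiag (λ j k → f 0 (suc j) k) n
      ⊕ antidiag (λ r k → antidiag (λ i j → f (suc i) j k) r) n)
      ≈⟨ +-congˡ (antidiag-⊕ _ _ n) ⟨
    f 0 0 (suc n) ⊕ antidiag (λ r k → f 0 (suc r) k
      ⊕ antidiag (λ i j → f (suc i) j k) r) n ∎

  -- The common shape of the three Pascal-type recurrences below: `g` comes from the first summand
  -- in the recursion of `hom`, and `h` from the second, which lowers the degree by one. The term of
  -- degree 0 has no second part.
  antidiag-step : ∀ f g h x n → f 0 (suc n) ≈ g 0 (suc n) →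
    (∀ i j → i + j ≡ n → f (suc i) j ≈ g (suc i) j ⊕ x ⊗ h i j) →
    antidiag f (suc n) ≈ antidiag g (suc n) ⊕ x ⊗ antidiag h n
  antidiag-step f g h x n f≈g f≈g⊕xh = begin
    f 0 (suc n) ⊕ antidiag (λ i → f (suc i)) n
      ≈⟨ +-cong f≈g (antidiag-cong n f≈g⊕xh) ⟩
    g 0 (suc n) ⊕ antidiag (λ i j → g (suc i) j ⊕ x ⊗ h i j) n
      ≈⟨ +-congˡ (antidiag-⊕ _ _ n) ⟩
    g 0 (suc n) ⊕ (antidiag (λ i → g (suc i)) n ⊕ antidiag (λ i j → x ⊗ h i j) n)
      ≈⟨ +-assoc _ _ _ ⟨
    antidiag g (suc n) ⊕ antidiag (λ i j → x ⊗ h i j) n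
      ≈⟨ +-congˡ (antidiag-*ˡ x h n) ⟩
    antidiag g (suc n) ⊕ x ⊗ antidiag h n ∎

-- The q-Vandermonde identity.

module QIdentities {c ℓ} (R : CommutativeSemiring c ℓ)
                   (𝕢 : CommutativeSemiring.Carrier R) where
  open CommutativeSemiring R
    renaming (_+_ to _⊕_; _*_ to _⊗_)
  open Exp semiring renaming (_^_ to infixr 8 _↑_)
  open SetoidReasoning setoid
  open AntidiagonalSum R
  open SemiringSolver R using (solve; _:+_; _:*_; _:=_; con)

  -- The complete homogeneous symmetric polynomial h_k(1, 𝕢, …, 𝕢^{m−1}),
  -- i.e. the q-binomial coefficient [m+k−1 choose k].
  hom : ℕ → ℕ → Carrier
  hom m       zero    = 1#
  hom zero    (suc k) = 0#
  hom (suc m) (suc k) = hom m (suc k) ⊕ 𝕢 ↑ m ⊗ hom (suc m) k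

  -- Among the variables 1, 𝕢, ..., 𝕢^{l+m-1}, the last `l` are 𝕢^m times 1, ..., 𝕢^{l-1}, so degree
  -- `j` in them costs 𝕢^{jm}. The induction removes the largest variable 𝕢^{l+m}: its 𝕢^l is
  -- supplied by the recursion of `hom (suc l)`, its 𝕢^m by the passage from `j * m` to `suc j * m`.
  hom-+ : ∀ m l k →
    antidiag (λ j i → 𝕢 ↑ (j * m) ⊗ hom l j ⊗ hom m i) k ≈ hom (l + m) k
  hom-+ m zero zero = trans (*-identityʳ _) (*-identityʳ _)
  hom-+ m zero (suc k) = begin
    1# ⊗ 1# ⊗ hom m (suc k) ⊕ antidiag (λ j i → 𝕢 ↑ (suc j * m) ⊗ 0# ⊗ hom m i) k
      ≈⟨ +-cong (trans (*-congʳ (*-identityˡ _)) (*-identityˡ _))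
                (antidiag-cong k λ j i _ → trans (*-congʳ (zeroʳ _)) (zeroˡ _)) ⟩
    hom m (suc k) ⊕ antidiag (λ _ _ → 0#) k
      ≈⟨ +-congˡ (antidiag-0 k) ⟩
    hom m (suc k) ⊕ 0#
      ≈⟨ +-identityʳ _ ⟩
    hom m (suc k) ∎
  hom-+ m (suc l) zero = trans (*-identityʳ _) (*-identityʳ _)
  hom-+ m (suc l) (suc k) = begin
    antidiag (λ j i → 𝕢 ↑ (j * m) ⊗ hom (suc l) j ⊗ hom m i) (suc k)
      ≈⟨ antidiag-step (term (suc l)) (term l) _ _ k refl (λ j i _ → step j i) ⟩
    antidiag (λ j i → 𝕢 ↑ (j * m) ⊗ hom l j ⊗ hom m i) (suc k)
      ⊕ 𝕢 ↑ (l + m) ⊗ antidiag (λ j i → 𝕢 ↑ (j * m) ⊗ hom (suc l) j ⊗ hom m i) k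
      ≈⟨ +-cong (hom-+ m l (suc k)) (*-congˡ (hom-+ m (suc l) k)) ⟩
    hom (l + m) (suc k) ⊕ 𝕢 ↑ (l + m) ⊗ hom (suc l + m) k ∎
    where
    term : ℕ → ℕ → ℕ → Carrier
    term l j i = 𝕢 ↑ (j * m) ⊗ hom l j ⊗ hom m i

    step : ∀ j i → 𝕢 ↑ (m + j * m) ⊗ (hom l (suc j) ⊕ 𝕢 ↑ l ⊗ hom (suc l) j) ⊗ hom m i ≈
           𝕢 ↑ (m + j * m) ⊗ hom l (suc j) ⊗ hom m i
             ⊕ 𝕢 ↑ (l + m) ⊗ (𝕢 ↑ (j * m) ⊗ hom (suc l) j ⊗ hom m i)
    step j i = begin
      𝕢 ↑ (m + j * m) ⊗ (hom l (suc j) ⊕ 𝕢 ↑ l ⊗ hom (suc l) j) ⊗ hom m i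
        ≈⟨ *-congʳ (*-congʳ (^-homo-* 𝕢 m (j * m))) ⟩
      𝕢 ↑ m ⊗ 𝕢 ↑ (j * m) ⊗ (hom l (suc j) ⊕ 𝕢 ↑ l ⊗ hom (suc l) j) ⊗ hom m i
        ≈⟨ solve 6 (λ x y z u v w → x :* y :* (z :+ u :* v) :* w :=
             x :* y :* z :* w :+ u :* x :* (y :* v :* w)) refl _ _ _ _ _ _ ⟩
      𝕢 ↑ m ⊗ 𝕢 ↑ (j * m) ⊗ hom l (suc j) ⊗ hom m i
        ⊕ 𝕢 ↑ l ⊗ 𝕢 ↑ m ⊗ (𝕢 ↑ (j * m) ⊗ hom (suc l) j ⊗ hom m i)
        ≈⟨ +-cong (*-congʳ (*-congʳ (^-homo-* 𝕢 m (j * m)))) (*-congʳ (^-homo-* 𝕢 l m)) ⟨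
      𝕢 ↑ (m + j * m) ⊗ hom l (suc j) ⊗ hom m i
        ⊕ 𝕢 ↑ (l + m) ⊗ (𝕢 ↑ (j * m) ⊗ hom (suc l) j ⊗ hom m i) ∎

  -- Weighted tilings by monomers and dominoes.

  -- The generating function, by 𝕢-weight, of the ways to place k dominoes
  -- and m − 1 monomers in a row.
  tilings : ℕ → ℕ → Carrier
  tilings m k = 𝕢 ↑ (k * k) ⊗ hom m k

  -- The row ends in a monomer or in a domino. Its length is `m + 2k + 2`, and a final domino weighs
  -- 𝕢 to the length minus one. Algebraically this is q-Pascal together with (k+1)² + m = (m+2k+1) +
  -- k².
  tilings-suc : ∀ m k →
    tilings (suc m) (suc k) ≈ tilings m (suc k) ⊕ 𝕢 ↑ (suc (m + k * 2)) ⊗ tilings (suc m) k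
  tilings-suc m k = begin
    𝕢 ↑ (suc k * suc k) ⊗ (hom m (suc k) ⊕ 𝕢 ↑ m ⊗ hom (suc m) k)
      ≈⟨ solve 4 (λ x y z w → x :* (y :+ z :* w) := x :* y :+ x :* z :* w) refl _ _ _ _ ⟩
    𝕢 ↑ (suc k * suc k) ⊗ hom m (suc k) ⊕ 𝕢 ↑ (suc k * suc k) ⊗ 𝕢 ↑ m ⊗ hom (suc m) k
      ≈⟨ +-congˡ (*-congʳ exponents) ⟩
    𝕢 ↑ (suc k * suc k) ⊗ hom m (suc k)
      ⊕ 𝕢 ↑ (suc (m + k * 2)) ⊗ 𝕢 ↑ (k * k) ⊗ hom (suc m) k
      ≈⟨ +-congˡ (*-assoc _ _ _) ⟩
    tilings m (suc k) ⊕ 𝕢 ↑ (suc (m + k * 2)) ⊗ tilings (suc m) k ∎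
    where
    squares : ∀ m k → suc k * suc k + m ≡ suc (m + k * 2) + k * k
    squares = solve-∀

    exponents : 𝕢 ↑ (suc k * suc k) ⊗ 𝕢 ↑ m ≈ 𝕢 ↑ (suc (m + k * 2)) ⊗ 𝕢 ↑ (k * k)
    exponents = begin
      𝕢 ↑ (suc k * suc k) ⊗ 𝕢 ↑ m           ≈⟨ ^-homo-* 𝕢 (suc k * suc k) m ⟨
      𝕢 ↑ (suc k * suc k + m)               ≈⟨ ^-congʳ 𝕢 (squares m k) ⟩
      𝕢 ↑ (suc (m + k * 2) + k * k)         ≈⟨ ^-homo-* 𝕢 (suc (m + k * 2)) (k * k) ⟩
      𝕢 ↑ (suc (m + k * 2)) ⊗ 𝕢 ↑ (k * k)   ∎

  -- Here `x` stands for `ab`, the weight of a pair of monomers. With `k` dominoes, `oddTerm` has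
  -- `2m` monomers and `evenTerm` has `2m + 1`, the weight `a` of the unpaired one being left out.
  -- Summed over k + m = n, they are to become F_{2n+1} and F_{2n+2} / a.
  oddTerm evenTerm : Carrier → ℕ → ℕ → Carrier
  oddTerm  x k m = x ↑ m ⊗ tilings (suc (m * 2)) k
  evenTerm x k m = x ↑ m ⊗ tilings (suc m * 2) k

  oddFib evenFib : Carrier → ℕ → Carrier
  oddFib  x = antidiag (oddTerm x)
  evenFib x = antidiag (evenTerm x)

  private
    weighted : ∀ {w t u v} z → t ≈ u ⊕ w ⊗ v → z ⊗ t ≈ z ⊗ u ⊕ w ⊗ (z ⊗ v)
    weighted z t≈u⊕wv = trans (*-congˡ t≈u⊕wv)
      (solve 4 (λ z u w v → z :* (u :+ w :* v) := z :* u :+ w :* (z :* v)) refl _ _ _ _)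

  -- The last tile is removed. The weight of a final domino depends on `k` and `m` only through
  -- `k + m`, so it can be taken out of the sum.
  evenFib-suc : ∀ x n →
    evenFib x (suc n) ≈ oddFib x (suc n) ⊕ 𝕢 ↑ (suc n * 2) ⊗ evenFib x n
  evenFib-suc x n = antidiag-step (evenTerm x) (oddTerm x) _ _ n refl λ k m k+m≡n →
    weighted (x ↑ m) (trans (tilings-suc (suc (m * 2)) k)
      (+-congˡ (*-congʳ (^-congʳ 𝕢 (≡.trans (index k m) (≡.cong (λ n → suc n * 2) k+m≡n))))))
    where
    index : ∀ k m → suc (suc (m * 2) + k * 2) ≡ suc (k + m) * 2
    index = solve-∀

  -- Again the last tile is removed, but taking a monomer from `2m` of them breaks up a pair:
  -- `2m − 1` are left, and shifting `m` by one releases a factor `x`.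
  oddFib-suc : ∀ x n →
    oddFib x (suc n) ≈ x ⊗ evenFib x n ⊕ 𝕢 ↑ (suc (n * 2)) ⊗ oddFib x n
  oddFib-suc x n = begin
    oddFib x (suc n)
      ≈⟨ antidiag-step (oddTerm x) lowered _ _ n refl (λ k m k+m≡n →
           weighted (x ↑ m) (trans (tilings-suc (m * 2) k)
             (+-congˡ (*-congʳ (^-congʳ 𝕢
               (≡.trans (index k m) (≡.cong (λ n → suc (n * 2)) k+m≡n))))))) ⟩
    antidiag lowered (suc n) ⊕ 𝕢 ↑ (suc (n * 2)) ⊗ oddFib x n
      ≈⟨ +-congʳ evens ⟩
    x ⊗ evenFib x n ⊕ 𝕢 ↑ (suc (n * 2)) ⊗ oddFib x n ∎
    where
    lowered : ℕ → ℕ → Carrier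
    lowered k m = x ↑ m ⊗ tilings (m * 2) k

    index : ∀ k m → suc (m * 2 + k * 2) ≡ suc ((k + m) * 2)
    index = solve-∀

    -- The term with `m = 0` contains `hom 0 (suc n)`, which is 0: there is no monomer to remove. In
    -- the others, `m` is shifted down by one.
    evens : antidiag lowered (suc n) ≈ x ⊗ evenFib x n
    evens = begin
      antidiag lowered (suc n)
        ≈⟨ antidiag-last lowered n ⟩
      antidiag (λ k m → x ⊗ x ↑ m ⊗ tilings (suc m * 2) k) n
        ⊕ 1# ⊗ (𝕢 ↑ (suc n * suc n) ⊗ 0#)
        ≈⟨ +-cong (antidiag-cong n λ k m _ → *-assoc _ _ _)
                  (trans (*-congˡ (zeroʳ _)) (zeroʳ _)) ⟩
      antidiag (λ k m → x ⊗ (x ↑ m ⊗ tilings (suc m * 2) k)) n ⊕ 0#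
        ≈⟨ +-identityʳ _ ⟩
      antidiag (λ k m → x ⊗ (x ↑ m ⊗ tilings (suc m * 2) k)) n
        ≈⟨ antidiag-*ˡ x _ n ⟩
      x ⊗ evenFib x n ∎

  -- The parameter `m` is n - i - j, and the two powers of `ab` are already merged into `x ↑ m`.
  summand : Carrier → ℕ → ℕ → ℕ → Carrier
  summand x i j m =
    x ↑ m ⊗ 𝕢 ↑ (i ^ 2 + (i + (j + m) + i + 1) * j) ⊗ hom (suc m) i ⊗ hom (suc m) j

  -- The exponent equals (i+j)² + j(m+1). The square depends on `k` alone and is the tiling weight;
  -- the rest is the q-Vandermonde weight for two blocks of `m + 1` variables.
  summand-tilings : ∀ x k m →
    antidiag (λ i j → summand x i j m) k ≈ x ↑ m ⊗ tilings (suc m * 2) k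
  summand-tilings x k m = begin
    antidiag (λ i j → summand x i j m) k
      ≈⟨ antidiag-cong k factor ⟩
    antidiag (λ i j → y ⊗ (𝕢 ↑ (j * suc m) ⊗ hom (suc m) j ⊗ hom (suc m) i)) k
      ≈⟨ antidiag-*ˡ y _ k ⟩
    y ⊗ antidiag (λ i j → 𝕢 ↑ (j * suc m) ⊗ hom (suc m) j ⊗ hom (suc m) i) k
      ≈⟨ *-congˡ (antidiag-swap _ k) ⟩
    y ⊗ antidiag (λ j i → 𝕢 ↑ (j * suc m) ⊗ hom (suc m) j ⊗ hom (suc m) i) k
      ≈⟨ *-congˡ (hom-+ (suc m) (suc m) k) ⟩
    y ⊗ hom (suc m + suc m) k
      ≈⟨ *-congˡ (reflexive (≡.cong (λ l → hom l k) (double (suc m)))) ⟩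
    y ⊗ hom (suc m * 2) k
      ≈⟨ *-assoc _ _ _ ⟩
    x ↑ m ⊗ tilings (suc m * 2) k ∎
    where
    y = x ↑ m ⊗ 𝕢 ↑ (k * k)

    double : ∀ m → m + m ≡ m * 2
    double = solve-∀

    exponent : ∀ i j m → i ^ 2 + (i + (j + m) + i + 1) * j ≡ (i + j) * (i + j) + j * suc m
    exponent = expand
      -- The same identity with `i ^ 2` unfolded, so that only sums and products remain.
      where
      expand : ∀ i j m → i * (i * 1) + (i + (j + m) + i + 1) * j ≡
                         (i + j) * (i + j) + j * suc m
      expand = solve-∀

    factor : ∀ i j → i + j ≡ k →
      summand x i j m ≈ y ⊗ (𝕢 ↑ (j * suc m) ⊗ hom (suc m) j ⊗ hom (suc m) i)
    factor i j ≡.refl = begin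
      summand x i j m
        ≈⟨ *-congʳ (*-congʳ (*-congˡ (trans (^-congʳ 𝕢 (exponent i j m))
             (^-homo-* 𝕢 ((i + j) * (i + j)) (j * suc m))))) ⟩
      x ↑ m ⊗ (𝕢 ↑ ((i + j) * (i + j)) ⊗ 𝕢 ↑ (j * suc m)) ⊗ hom (suc m) i ⊗ hom (suc m) j
        ≈⟨ solve 5 (λ x y z u v → x :* (y :* z) :* u :* v := x :* y :* (z :* v :* u))
             refl _ _ _ _ _ ⟩
      y ⊗ (𝕢 ↑ (j * suc m) ⊗ hom (suc m) j ⊗ hom (suc m) i) ∎

  evenFib-double-sum : ∀ x n →
    evenFib x n ≈ antidiag (λ i r → antidiag (λ j m → summand x i j m) r) n
  evenFib-double-sum x n = begin
    evenFib x n
      ≈⟨ antidiag-cong n (λ k m _ → summand-tilings x k m) ⟨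
    antidiag (λ k m → antidiag (λ i j → summand x i j m) k) n
      ≈⟨ antidiag-assoc (summand x) n ⟨
    antidiag (λ i r → antidiag (λ j m → summand x i j m) r) n ∎

-- The commutative semiring of polynomials in q.

≈ᵖ-isEquivalence : IsEquivalence _≈ᵖ_
≈ᵖ-isEquivalence = record
  { refl  = mk≈ λ _ → ≡.refl
  ; sym   = λ p≈r → mk≈ λ k → ≡.sym (p≈r .coeff-≡ k)
  ; trans = λ p≈r r≈s → mk≈ λ k → ≡.trans (p≈r .coeff-≡ k) (r≈s .coeff-≡ k)
  }

+ᵖ-commutativeMonoid : CommutativeMonoid 0ℓ 0ℓ
+ᵖ-commutativeMonoid = record
  { Carrier = ℤ[q]
  ; _≈_     = _≈ᵖ_
  ; _∙_     = _+ᵖ_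
  ; ε       = 0ᵖ
  ; isCommutativeMonoid = record
    { isMonoid = record
      { isSemigroup = record
        { isMagma = record
          { isEquivalence = ≈ᵖ-isEquivalence
          ; ∙-cong = λ {p} {p′} {r} {r′} p≈p′ r≈r′ → coeffwise (p +ᵖ r) (p′ +ᵖ r′) λ k →
              via (coeff-+ᵖ p r k) (coeff-+ᵖ p′ r′ k)
                (≡.cong₂ ℤ._+_ (p≈p′ .coeff-≡ k) (r≈r′ .coeff-≡ k))
          }
        ; assoc = λ p r s → coeffwise ((p +ᵖ r) +ᵖ s) (p +ᵖ (r +ᵖ s)) λ k →
            via (≡.trans (coeff-+ᵖ (p +ᵖ r) s k) (≡.cong (ℤ._+ coeff s k) (coeff-+ᵖ p r k)))
                (≡.trans (coeff-+ᵖ p (r +ᵖ s) k) (≡.cong (λ z → coeff p k ℤ.+ z) (coeff-+ᵖ r s k)))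
                (ℤ.+-assoc (coeff p k) (coeff r k) (coeff s k))
        }
      ; identity = (λ p → mk≈ λ _ → ≡.refl)
                 , λ p → coeffwise (p +ᵖ 0ᵖ) p λ k →
                     ≡.trans (coeff-+ᵖ p 0ᵖ k) (ℤ.+-identityʳ (coeff p k))
      }
    ; comm = λ p r → coeffwise (p +ᵖ r) (r +ᵖ p) λ k →
        via (coeff-+ᵖ p r k) (coeff-+ᵖ r p k) (ℤ.+-comm (coeff p k) (coeff r k))
    }
  }
  where
  coeffwise : ∀ p r → (∀ k → coeff p k ≡ coeff r k) → p ≈ᵖ r
  coeffwise _ _ = mk≈

  via : ∀ {u v w x : ℤ} → u ≡ w → v ≡ x → w ≡ x → u ≡ v
  via u≡w v≡x w≡x = ≡.trans u≡w (≡.trans w≡x (≡.sym v≡x))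

module _ where
  open CommutativeMonoid +ᵖ-commutativeMonoid
    renaming (∙-cong to +ᵖ-cong; ∙-congˡ to +ᵖ-congˡ; ∙-congʳ to +ᵖ-congʳ;
              identityʳ to +ᵖ-identityʳ)
  open CommutativeSemigroupProperties commutativeSemigroup using (interchange; x∙yz≈y∙xz)
  open SetoidReasoning setoid

  ∷-cong : ∀ {c d p r} → c ≡ d → p ≈ᵖ r → c ∷ p ≈ᵖ d ∷ r
  ∷-cong c≡d p≈r .coeff-≡ zero    = c≡d
  ∷-cong c≡d p≈r .coeff-≡ (suc k) = p≈r .coeff-≡ k

  0∷[]≈[] : 0ℤ ∷ [] ≈ᵖ []
  0∷[]≈[] .coeff-≡ zero    = ≡.refl
  0∷[]≈[] .coeff-≡ (suc k) = ≡.refl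

  ·ᵖ-cong : ∀ c {p r} → p ≈ᵖ r → c ·ᵖ p ≈ᵖ c ·ᵖ r
  ·ᵖ-cong c {p} {r} p≈r .coeff-≡ k =
    ≡.trans (coeff-·ᵖ c p k)
      (≡.trans (≡.cong (c ℤ.*_) (p≈r .coeff-≡ k)) (≡.sym (coeff-·ᵖ c r k)))

  ·ᵖ-distribˡ : ∀ c p r → c ·ᵖ (p +ᵖ r) ≈ᵖ c ·ᵖ p +ᵖ c ·ᵖ r
  ·ᵖ-distribˡ c []      r       = refl
  ·ᵖ-distribˡ c (d ∷ p) []      = refl
  ·ᵖ-distribˡ c (d ∷ p) (e ∷ r) = ∷-cong (ℤ.*-distribˡ-+ c d e) (·ᵖ-distribˡ c p r)

  ·ᵖ-assoc : ∀ c d p → (c ℤ.* d) ·ᵖ p ≈ᵖ c ·ᵖ (d ·ᵖ p)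
  ·ᵖ-assoc c d []      = refl
  ·ᵖ-assoc c d (e ∷ p) = ∷-cong (ℤ.*-assoc c d e) (·ᵖ-assoc c d p)

  ·ᵖ-zeroˡ : ∀ p → 0ℤ ·ᵖ p ≈ᵖ 0ᵖ
  ·ᵖ-zeroˡ []      = refl
  ·ᵖ-zeroˡ (c ∷ p) = trans (∷-cong (ℤ.*-zeroˡ c) (·ᵖ-zeroˡ p)) 0∷[]≈[]

  ·ᵖ-identityˡ : ∀ p → 1ℤ ·ᵖ p ≈ᵖ p
  ·ᵖ-identityˡ []      = refl
  ·ᵖ-identityˡ (c ∷ p) = ∷-cong (ℤ.*-identityˡ c) (·ᵖ-identityˡ p)

  *ᵖ-congˡ : ∀ p {r s} → r ≈ᵖ s → p *ᵖ r ≈ᵖ p *ᵖ s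
  *ᵖ-congˡ []      r≈s = refl
  *ᵖ-congˡ (c ∷ p) r≈s = +ᵖ-cong (·ᵖ-cong c r≈s) (∷-cong ≡.refl (*ᵖ-congˡ p r≈s))

  *ᵖ-zeroʳ : ∀ p → p *ᵖ 0ᵖ ≈ᵖ 0ᵖ
  *ᵖ-zeroʳ []      = refl
  *ᵖ-zeroʳ (c ∷ p) = trans (∷-cong ≡.refl (*ᵖ-zeroʳ p)) 0∷[]≈[]

  -- The mirror image of the defining recursion of `_*ᵖ_`; with it, commutativity is an induction on
  -- the left factor.
  *ᵖ-∷ : ∀ p d r → p *ᵖ (d ∷ r) ≈ᵖ d ·ᵖ p +ᵖ (0ℤ ∷ (p *ᵖ r))
  *ᵖ-∷ []      d r = sym 0∷[]≈[]
  *ᵖ-∷ (c ∷ p) d r =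
    ∷-cong (≡.cong (ℤ._+ 0ℤ) (ℤ.*-comm c d)) (begin
      c ·ᵖ r +ᵖ p *ᵖ (d ∷ r)                    ≈⟨ +ᵖ-congˡ (*ᵖ-∷ p d r) ⟩
      c ·ᵖ r +ᵖ (d ·ᵖ p +ᵖ (0ℤ ∷ (p *ᵖ r)))     ≈⟨ x∙yz≈y∙xz (c ·ᵖ r) (d ·ᵖ p) _ ⟩
      d ·ᵖ p +ᵖ (c ·ᵖ r +ᵖ (0ℤ ∷ (p *ᵖ r)))     ∎)

  *ᵖ-comm : ∀ p r → p *ᵖ r ≈ᵖ r *ᵖ p
  *ᵖ-comm []      r = sym (*ᵖ-zeroʳ r)
  *ᵖ-comm (c ∷ p) r = begin
    c ·ᵖ r +ᵖ (0ℤ ∷ (p *ᵖ r))   ≈⟨ +ᵖ-congˡ (∷-cong ≡.refl (*ᵖ-comm p r)) ⟩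
    c ·ᵖ r +ᵖ (0ℤ ∷ (r *ᵖ p))   ≈⟨ *ᵖ-∷ r c p ⟨
    r *ᵖ (c ∷ p)                ∎

  *ᵖ-congʳ : ∀ r {p s} → p ≈ᵖ s → p *ᵖ r ≈ᵖ s *ᵖ r
  *ᵖ-congʳ r {p} {s} p≈s = trans (*ᵖ-comm p r) (trans (*ᵖ-congˡ r p≈s) (*ᵖ-comm r s))

  *ᵖ-distribˡ : ∀ p r s → p *ᵖ (r +ᵖ s) ≈ᵖ p *ᵖ r +ᵖ p *ᵖ s
  *ᵖ-distribˡ []      r s = refl
  *ᵖ-distribˡ (c ∷ p) r s = begin
    c ·ᵖ (r +ᵖ s) +ᵖ (0ℤ ∷ (p *ᵖ (r +ᵖ s)))
      ≈⟨ +ᵖ-cong (·ᵖ-distribˡ c r s) (∷-cong ≡.refl (*ᵖ-distribˡ p r s)) ⟩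
    (c ·ᵖ r +ᵖ c ·ᵖ s) +ᵖ ((0ℤ ∷ (p *ᵖ r)) +ᵖ (0ℤ ∷ (p *ᵖ s)))
      ≈⟨ interchange (c ·ᵖ r) (c ·ᵖ s) _ _ ⟩
    (c ∷ p) *ᵖ r +ᵖ (c ∷ p) *ᵖ s ∎

  *ᵖ-distribʳ : ∀ p r s → (r +ᵖ s) *ᵖ p ≈ᵖ r *ᵖ p +ᵖ s *ᵖ p
  *ᵖ-distribʳ p r s = begin
    (r +ᵖ s) *ᵖ p        ≈⟨ *ᵖ-comm (r +ᵖ s) p ⟩
    p *ᵖ (r +ᵖ s)        ≈⟨ *ᵖ-distribˡ p r s ⟩
    p *ᵖ r +ᵖ p *ᵖ s     ≈⟨ +ᵖ-cong (*ᵖ-comm p r) (*ᵖ-comm p s) ⟩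
    r *ᵖ p +ᵖ s *ᵖ p     ∎

  0∷-*ᵖ : ∀ p r → (0ℤ ∷ p) *ᵖ r ≈ᵖ 0ℤ ∷ (p *ᵖ r)
  0∷-*ᵖ p r = +ᵖ-congʳ (·ᵖ-zeroˡ r)

  ·ᵖ-*ᵖ : ∀ c p r → (c ·ᵖ p) *ᵖ r ≈ᵖ c ·ᵖ (p *ᵖ r)
  ·ᵖ-*ᵖ c []      r = refl
  ·ᵖ-*ᵖ c (d ∷ p) r = begin
    (c ℤ.* d) ·ᵖ r +ᵖ (0ℤ ∷ ((c ·ᵖ p) *ᵖ r))
      ≈⟨ +ᵖ-cong (·ᵖ-assoc c d r) (∷-cong (≡.sym (ℤ.*-zeroʳ c)) (·ᵖ-*ᵖ c p r)) ⟩
    c ·ᵖ (d ·ᵖ r) +ᵖ c ·ᵖ (0ℤ ∷ (p *ᵖ r))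
      ≈⟨ ·ᵖ-distribˡ c (d ·ᵖ r) (0ℤ ∷ (p *ᵖ r)) ⟨
    c ·ᵖ ((d ∷ p) *ᵖ r) ∎

  *ᵖ-assoc : ∀ p r s → (p *ᵖ r) *ᵖ s ≈ᵖ p *ᵖ (r *ᵖ s)
  *ᵖ-assoc []      r s = refl
  *ᵖ-assoc (c ∷ p) r s = begin
    (c ·ᵖ r +ᵖ (0ℤ ∷ (p *ᵖ r))) *ᵖ s
      ≈⟨ *ᵖ-distribʳ s (c ·ᵖ r) (0ℤ ∷ (p *ᵖ r)) ⟩
    (c ·ᵖ r) *ᵖ s +ᵖ (0ℤ ∷ (p *ᵖ r)) *ᵖ s
      ≈⟨ +ᵖ-cong (·ᵖ-*ᵖ c r s)
           (trans (0∷-*ᵖ (p *ᵖ r) s) (∷-cong ≡.refl (*ᵖ-assoc p r s))) ⟩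
    c ·ᵖ (r *ᵖ s) +ᵖ (0ℤ ∷ (p *ᵖ (r *ᵖ s))) ∎

  *ᵖ-identityˡ : ∀ p → 1ᵖ *ᵖ p ≈ᵖ p
  *ᵖ-identityˡ p = begin
    1ℤ ·ᵖ p +ᵖ (0ℤ ∷ [])   ≈⟨ +ᵖ-cong (·ᵖ-identityˡ p) 0∷[]≈[] ⟩
    p +ᵖ 0ᵖ                ≈⟨ +ᵖ-identityʳ p ⟩
    p                      ∎

  ℤ[q]-commutativeSemiring : CommutativeSemiring 0ℓ 0ℓ
  ℤ[q]-commutativeSemiring = record
    { Carrier = ℤ[q]
    ; _≈_     = _≈ᵖ_
    ; _+_     = _+ᵖ_
    ; _*_     = _*ᵖ_
    ; 0#      = 0ᵖ
    ; 1#      = 1ᵖ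
    ; isCommutativeSemiring = IsCommutativeSemiringˡ.isCommutativeSemiring record
      { +-isCommutativeMonoid = isCommutativeMonoid
      ; *-isCommutativeMonoid = record
        { isMonoid = record
          { isSemigroup = record
            { isMagma = record
              { isEquivalence = isEquivalence
              ; ∙-cong = λ {p} {p′} {r} {r′} p≈p′ r≈r′ →
                  trans (*ᵖ-congʳ r p≈p′) (*ᵖ-congˡ p′ r≈r′)
              }
            ; assoc = *ᵖ-assoc
            }
          ; identity = *ᵖ-identityˡ
                     , λ p → trans (*ᵖ-comm p 1ᵖ) (*ᵖ-identityˡ p)
          }
        ; comm = *ᵖ-comm
        }
      ; distribʳ = *ᵖ-distribʳ
      ; zeroˡ    = λ p → refl
      }
    }

open CommutativeSemiring ℤ[q]-commutativeSemiring
  using (setoid; refl; sym; trans; reflexive; +-identityʳ; zeroʳ; distribˡ)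
  renaming ( +-cong to +ᵖ-cong; +-congˡ to +ᵖ-congˡ; +-congʳ to +ᵖ-congʳ
           ; *-cong to *-congᵖ; *-congˡ to *-congˡᵖ; *-congʳ to *-congʳᵖ
           ; *-identityˡ to *-identityˡᵖ; *-identityʳ to *-identityʳᵖ
           ; *-assoc to *-assocᵖ; semiring to ℤ[q]-semiring )
open Exp ℤ[q]-semiring using (^-homo-*; ^-congʳ)
open AntidiagonalSum ℤ[q]-commutativeSemiring
open QIdentities ℤ[q]-commutativeSemiring q
open SemiringSolver ℤ[q]-commutativeSemiring using (solve; _:+_; _:*_; _:=_; con)
open SetoidReasoning setoid

-- q-integers and q-factorials.

q-*ᵖ : ∀ p → q *ᵖ p ≈ᵖ 0ℤ ∷ p
q-*ᵖ p = trans (0∷-*ᵖ 1ᵖ p) (∷-cong ≡.refl (*ᵖ-identityˡ p))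

const-* : ∀ m n → const (m * n) ≈ᵖ const m *ᵖ const n
const-* m n = ∷-cong (≡.trans (ℤ.pos-* m n) (≡.sym (ℤ.+-identityʳ (+ m ℤ.* + n)))) refl

const-^ : ∀ m k → const (m ^ k) ≈ᵖ const m ^ᵖ k
const-^ m zero    = refl
const-^ m (suc k) = trans (const-* m (m ^ k)) (*-congˡᵖ {const m} (const-^ m k))

[+]q : ∀ m k → [ m + k ]q ≈ᵖ [ m ]q +ᵖ q ^ᵖ m *ᵖ [ k ]q
[+]q zero    k = sym (*ᵖ-identityˡ [ k ]q)
[+]q (suc m) k = begin
  1ℤ ∷ [ m + k ]q                                  ≈⟨ ∷-cong ≡.refl ([+]q m k) ⟩
  [ suc m ]q +ᵖ (0ℤ ∷ (q ^ᵖ m *ᵖ [ k ]q))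
    ≈⟨ +ᵖ-congˡ {[ suc m ]q} (q-*ᵖ (q ^ᵖ m *ᵖ [ k ]q)) ⟨
  [ suc m ]q +ᵖ q *ᵖ (q ^ᵖ m *ᵖ [ k ]q)
    ≈⟨ +ᵖ-congˡ {[ suc m ]q} (*-assocᵖ q (q ^ᵖ m) [ k ]q) ⟨
  [ suc m ]q +ᵖ q ^ᵖ suc m *ᵖ [ k ]q ∎

-- This identifies `hom (suc m) k` with the q-binomial coefficient [m+k choose k] without dividing.
-- In the main case both parts of the q-Pascal rule yield the factor [m+k+1]!, and the cofactors add
-- up by [m+k+2] = [m+1] + q^{m+1} [k+1].
hom-[]q! : ∀ m k → hom (suc m) k *ᵖ ([ k ]q! *ᵖ [ m ]q!) ≈ᵖ [ m + k ]q!
hom-[]q! m zero = begin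
  1ᵖ *ᵖ (1ᵖ *ᵖ [ m ]q!)   ≈⟨ *-identityˡᵖ (1ᵖ *ᵖ [ m ]q!) ⟩
  1ᵖ *ᵖ [ m ]q!           ≈⟨ *-identityˡᵖ [ m ]q! ⟩
  [ m ]q!                 ≡⟨ ≡.cong [_]q! (ℕ.+-identityʳ m) ⟨
  [ m + 0 ]q!             ∎
hom-[]q! zero (suc k) = begin
  (1ᵖ *ᵖ hom 1 k) *ᵖ (([ k ]q! *ᵖ [ suc k ]q) *ᵖ 1ᵖ)
    ≈⟨ solve 3 (λ u v w → (con 1 :* u) :* ((v :* w) :* con 1) := (u :* (v :* con 1)) :* w)
         refl (hom 1 k) [ k ]q! [ suc k ]q ⟩
  (hom 1 k *ᵖ ([ k ]q! *ᵖ 1ᵖ)) *ᵖ [ suc k ]q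
    ≈⟨ *-congʳᵖ {[ suc k ]q} (hom-[]q! 0 k) ⟩
  [ k ]q! *ᵖ [ suc k ]q ∎
hom-[]q! (suc m) (suc k) = begin
  (u +ᵖ y *ᵖ v) *ᵖ (([ k ]q! *ᵖ [ suc k ]q) *ᵖ ([ m ]q! *ᵖ [ suc m ]q))
    ≈⟨ solve 7 (λ u y v K k′ M m′ →
         (u :+ y :* v) :* ((K :* k′) :* (M :* m′)) :=
         (u :* ((K :* k′) :* M)) :* m′ :+ (v :* (K :* (M :* m′))) :* (y :* k′))
         refl u y v [ k ]q! [ suc k ]q [ m ]q! [ suc m ]q ⟩
  (u *ᵖ ([ suc k ]q! *ᵖ [ m ]q!)) *ᵖ [ suc m ]q
    +ᵖ (v *ᵖ ([ k ]q! *ᵖ [ suc m ]q!)) *ᵖ (y *ᵖ [ suc k ]q)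
    ≈⟨ +ᵖ-cong (*-congʳᵖ {[ suc m ]q} (hom-[]q! m (suc k)))
         (*-congʳᵖ {y *ᵖ [ suc k ]q} (trans (hom-[]q! (suc m) k)
           (reflexive (≡.cong [_]q! (≡.sym (ℕ.+-suc m k)))))) ⟩
  [ m + suc k ]q! *ᵖ [ suc m ]q +ᵖ [ m + suc k ]q! *ᵖ (y *ᵖ [ suc k ]q)
    ≈⟨ distribˡ [ m + suc k ]q! [ suc m ]q (y *ᵖ [ suc k ]q) ⟨
  [ m + suc k ]q! *ᵖ ([ suc m ]q +ᵖ y *ᵖ [ suc k ]q)
    ≈⟨ *-congˡᵖ {[ m + suc k ]q!} ([+]q (suc m) (suc k)) ⟨
  [ suc m + suc k ]q! ∎
  where
  u = hom (suc m) (suc k)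
  v = hom (suc (suc m)) k
  y = q ^ᵖ suc m

-- Fractions that equal a polynomial.

-- x = p in ℚ(q).  Unlike for _≃_, compatibility with _+ᶠ_ and _*ᶠ_ and replacing p by
-- an equal polynomial need no cancellation.
infix 4 _⇓_

record _⇓_ (x : ℚ⟨q⟩) (p : ℤ[q]) : Set where
  constructor mk⇓
  field num≈ : num x ≈ᵖ p *ᵖ den x

⇓-ι : ∀ p → ι p ⇓ p
⇓-ι p = mk⇓ (sym (*-identityʳᵖ p))

⇓-resp : ∀ {x p r} → p ≈ᵖ r → x ⇓ p → x ⇓ r
⇓-resp {x} p≈r (mk⇓ x⇓p) = mk⇓ (trans x⇓p (*-congʳᵖ {den x} p≈r))

⇓-+ : ∀ {x y p r} → x ⇓ p → y ⇓ r → x +ᶠ y ⇓ p +ᵖ r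
⇓-+ {x} {y} {p} {r} (mk⇓ x⇓p) (mk⇓ y⇓r) = mk⇓ (begin
  num x *ᵖ den y +ᵖ num y *ᵖ den x
    ≈⟨ +ᵖ-cong (*-congʳᵖ {den y} x⇓p) (*-congʳᵖ {den x} y⇓r) ⟩
  (p *ᵖ den x) *ᵖ den y +ᵖ (r *ᵖ den y) *ᵖ den x
    ≈⟨ solve 4 (λ p d r e → (p :* d) :* e :+ (r :* e) :* d := (p :+ r) :* (d :* e))
         refl p (den x) r (den y) ⟩
  (p +ᵖ r) *ᵖ (den x *ᵖ den y) ∎)

⇓-* : ∀ {x y p r} → x ⇓ p → y ⇓ r → x *ᶠ y ⇓ p *ᵖ r
⇓-* {x} {y} {p} {r} (mk⇓ x⇓p) (mk⇓ y⇓r) = mk⇓ (begin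
  num x *ᵖ num y                     ≈⟨ *-congᵖ x⇓p y⇓r ⟩
  (p *ᵖ den x) *ᵖ (r *ᵖ den y)
    ≈⟨ solve 4 (λ p d r e → (p :* d) :* (r :* e) := (p :* r) :* (d :* e))
         refl p (den x) r (den y) ⟩
  (p *ᵖ r) *ᵖ (den x *ᵖ den y)       ∎)

-- The other factor is arbitrary: beside a vanishing q-binomial coefficient it may be a negative
-- power of `ab`, which in general equals no polynomial.
⇓0-*ˡ : ∀ x y → x ⇓ 0ᵖ → x *ᶠ y ⇓ 0ᵖ
⇓0-*ˡ x y (mk⇓ x⇓0) = mk⇓ (*-congʳᵖ {num y} x⇓0)

⇓0-*ʳ : ∀ x y → y ⇓ 0ᵖ → x *ᶠ y ⇓ 0ᵖ
⇓0-*ʳ x y (mk⇓ y⇓0) = mk⇓ (trans (*-congˡᵖ {num x} y⇓0) (zeroʳ (num x)))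

⇓⇒≃ : ∀ {x p} → x ⇓ p → ι p ≃ x
⇓⇒≃ {x} (mk⇓ x⇓p) = mk≃ (trans (sym x⇓p) (sym (*-identityʳᵖ (num x))))

-- A restricted transitivity of `_≃_`: the first equation is between polynomials, so nothing has to
-- be cancelled.
ι-cong : ∀ {p r x} → p ≈ᵖ r → ι r ≃ x → ι p ≃ x
ι-cong {x = x} p≈r (mk≃ r≃x) = mk≃ (trans (*-congʳᵖ {den x} p≈r) r≃x)

∑≤-⇓0 : ∀ f n → (∀ j → f j ⇓ 0ᵖ) → ∑≤ n f ⇓ 0ᵖ
∑≤-⇓0 f zero    f⇓0 = ⇓-+ (f⇓0 0) (⇓-ι 0ᵖ)
∑≤-⇓0 f (suc n) f⇓0 = ⇓-+ (f⇓0 0) (∑≤-⇓0 (λ j → f (suc j)) n (λ j → f⇓0 (suc j)))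

-- This cuts the square range of the double sum down to the triangle i + j ≤ n. Terms of index 0 are
-- peeled off both sums until `r` is used up; what then remains on the left vanishes.
∑≤-⇓-antidiag : ∀ {f} g {r n} → r ≤ n →
  (∀ j m → j + m ≡ r → f j ⇓ g j m) → (∀ j → r < j → f j ⇓ 0ᵖ) →
  ∑≤ n f ⇓ antidiag g r
-- The fold behind `∑≤` starts from `ι 0ᵖ`, hence the extra zero summand.
∑≤-⇓-antidiag g {n = zero} z≤n f⇓g f⇓0 =
  ⇓-resp (+-identityʳ (g 0 0)) (⇓-+ (f⇓g 0 0 ≡.refl) (⇓-ι 0ᵖ))
∑≤-⇓-antidiag {f} g {n = suc n} z≤n f⇓g f⇓0 =
  ⇓-resp (+-identityʳ (g 0 0))
    (⇓-+ (f⇓g 0 0 ≡.refl) (∑≤-⇓0 (λ j → f (suc j)) n (λ j → f⇓0 (suc j) z<s)))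
∑≤-⇓-antidiag g (s≤s r≤n) f⇓g f⇓0 =
  ⇓-+ (f⇓g 0 _ ≡.refl)
    (∑≤-⇓-antidiag (λ j → g (suc j)) r≤n
      (λ j m eq → f⇓g (suc j) m (≡.cong suc eq))
      (λ j r<j → f⇓0 (suc j) (s<s r<j)))

-- Values of q-binomial coefficients, parities and powers.

qbinom-⇓ : ∀ m k → qbinom (m + k) k ⇓ hom (suc m) k
qbinom-⇓ m k with k ℕ.≤? m + k
... | no k≰m+k = contradiction (ℕ.m≤n+m k m) k≰m+k
... | yes _ rewrite ℕ.m+n∸n≡m m k = mk⇓ (sym (hom-[]q! m k))

qbinom-⇓0 : ∀ {n k} → n < k → qbinom n k ⇓ 0ᵖ
qbinom-⇓0 {n} {k} n<k with k ℕ.≤? n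
... | yes k≤n = contradiction k≤n (ℕ.<⇒≱ n<k)
... | no  _   = ⇓-ι 0ᵖ

[m+n]-m≡n : ∀ m n → + (m + n) - + m ≡ + n
[m+n]-m≡n m n = ≡.trans (ℤ.m-n≡m⊖n (m + n) m)
  (≡.trans (ℤ.⊖-≥ (ℕ.m≤m+n m n)) (≡.cong +_ (ℕ.m+n∸m≡n m n)))

m≡2[m/2]+m%2 : ∀ m → m ≡ 2 * (m / 2) + m % 2
m≡2[m/2]+m%2 m = ≡.trans (m≡m%n+[m/n]*n m 2)
  (≡.trans (ℕ.+-comm (m % 2) (m / 2 * 2)) (≡.cong (_+ m % 2) (ℕ.*-comm (m / 2) 2)))

ξ-+ : ∀ m → ξ (+ m) ≡ + (m % 2)
ξ-+ m = ≡.trans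
  -- For a nonnegative integer, `⌊ + m /2⌋` computes to `+ (m / 2)`.
  (≡.cong₂ (λ u v → + u - v) (m≡2[m/2]+m%2 m) (≡.sym (ℤ.pos-* 2 (m / 2))))
  ([m+n]-m≡n (2 * (m / 2)) (m % 2))

2⌊/2⌋-+ : ∀ m → + 2 ℤ.* ⌊ + m /2⌋ ≡ + (2 * (m / 2))
2⌊/2⌋-+ m = ≡.sym (ℤ.pos-* 2 (m / 2))

^ᶻ-⇓ : ∀ x .{{_ : NonZero x}} {z} {k} → z ≡ + k → x ^ᶻ z ⇓ const x ^ᵖ k
^ᶻ-⇓ x {k = k} ≡.refl = ⇓-resp (const-^ x k) (⇓-ι (const (x ^ k)))

-- Evaluation of the double sum.

module _ (x : ℕ) .{{_ : NonZero x}} where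
  prefactor postfactor term : ℕ → ℕ → ℕ → ℚ⟨q⟩
  prefactor n i j =
    x ^ᶻ ξ (+ n - + i - + j) *ᶠ ι (q ^ᵖ (i ^ 2 + (n + i + 1) * j))
  postfactor n i j = x ^ᶻ (+ 2 ℤ.* ⌊ + n - + i - + j /2⌋)
  term n i j =
    prefactor n i j *ᶠ qbinom (n ∸ j) i *ᶠ qbinom (n ∸ i) j *ᶠ postfactor n i j

  -- Inside the triangle n - i - j is the natural number `m`, so the exponents of `ab` are `m % 2`
  -- and `2 * (m / 2)`, which add up to `m`.
  term-⇓ : ∀ {n r} i j m → i + r ≡ n → j + m ≡ r →
           term n i j ⇓ summand (const x) i j m
  term-⇓ i j m ≡.refl ≡.refl = ⇓-resp collect
    (⇓-* (⇓-* (⇓-* (⇓-*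
      (^ᶻ-⇓ x (≡.trans (≡.cong ξ difference) (ξ-+ m)))
      (⇓-ι (q ^ᵖ e)))
      (≡.subst (λ l → qbinom l i ⇓ hom (suc m) i) (≡.sym n∸j) (qbinom-⇓ m i)))
      (≡.subst (λ l → qbinom l j ⇓ hom (suc m) j) (≡.sym n∸i) (qbinom-⇓ m j)))
      (^ᶻ-⇓ x (≡.trans (≡.cong (λ z → + 2 ℤ.* ⌊ z /2⌋) difference) (2⌊/2⌋-+ m))))
    where
    n = i + (j + m)
    e = i ^ 2 + (n + i + 1) * j

    difference : + n - + i - + j ≡ + m
    difference = ≡.trans (≡.cong (_- + j) ([m+n]-m≡n i (j + m))) ([m+n]-m≡n j m)

    n∸j : n ∸ j ≡ m + i
    n∸j = ≡.trans (≡.cong (_∸ j) (rotate i j m)) (ℕ.m+n∸m≡n j (m + i))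
      where
      rotate : ∀ i j m → i + (j + m) ≡ j + (m + i)
      rotate = solve-∀

    n∸i : n ∸ i ≡ m + j
    n∸i = ≡.trans (ℕ.m+n∸m≡n i (j + m)) (ℕ.+-comm j m)

    parity : m % 2 + 2 * (m / 2) ≡ m
    parity = ≡.trans (ℕ.+-comm (m % 2) (2 * (m / 2))) (≡.sym (m≡2[m/2]+m%2 m))

    collect : const x ^ᵖ (m % 2) *ᵖ q ^ᵖ e *ᵖ hom (suc m) i *ᵖ hom (suc m) j
                *ᵖ const x ^ᵖ (2 * (m / 2))
              ≈ᵖ summand (const x) i j m
    collect = begin
      const x ^ᵖ (m % 2) *ᵖ q ^ᵖ e *ᵖ hom (suc m) i *ᵖ hom (suc m) j
        *ᵖ const x ^ᵖ (2 * (m / 2))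
        ≈⟨ solve 5 (λ s y u v t → s :* y :* u :* v :* t := s :* t :* y :* u :* v) refl
             (const x ^ᵖ (m % 2)) (q ^ᵖ e) (hom (suc m) i) (hom (suc m) j)
             (const x ^ᵖ (2 * (m / 2))) ⟩
      const x ^ᵖ (m % 2) *ᵖ const x ^ᵖ (2 * (m / 2)) *ᵖ q ^ᵖ e
        *ᵖ hom (suc m) i *ᵖ hom (suc m) j
        ≈⟨ *-congʳᵖ {hom (suc m) j} (*-congʳᵖ {hom (suc m) i} (*-congʳᵖ {q ^ᵖ e}
             (trans (sym (^-homo-* (const x) (m % 2) (2 * (m / 2)))) (^-congʳ (const x) parity)))) ⟩
      summand (const x) i j m ∎

  -- Since `n ∸ i` is `r`, the second q-binomial coefficient vanishes.
  term-⇓0ʲ : ∀ {n r} i j → i + r ≡ n → r < j → term n i j ⇓ 0ᵖ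
  term-⇓0ʲ {n} {r} i j ≡.refl r<j =
    ⇓0-*ˡ (prefactor n i j *ᶠ qbinom (n ∸ j) i *ᶠ qbinom (n ∸ i) j) (postfactor n i j)
      (⇓0-*ʳ (prefactor n i j *ᶠ qbinom (n ∸ j) i) (qbinom (n ∸ i) j)
        (qbinom-⇓0 (≡.subst (_< j) (≡.sym (ℕ.m+n∸m≡n i r)) r<j)))

  -- Here the first q-binomial coefficient vanishes, because `n ∸ j` is at most `n`.
  term-⇓0ⁱ : ∀ {n} i j → n < i → term n i j ⇓ 0ᵖ
  term-⇓0ⁱ {n} i j n<i =
    ⇓0-*ˡ (prefactor n i j *ᶠ qbinom (n ∸ j) i *ᶠ qbinom (n ∸ i) j) (postfactor n i j)
      (⇓0-*ˡ (prefactor n i j *ᶠ qbinom (n ∸ j) i) (qbinom (n ∸ i) j)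
        (⇓0-*ʳ (prefactor n i j) (qbinom (n ∸ j) i)
          (qbinom-⇓0 (ℕ.≤-<-trans (ℕ.m∸n≤m n j) n<i))))

  ∑∑term-⇓ : ∀ n → (∑[ i ≤ n ] ∑[ j ≤ n ] term n i j) ⇓ evenFib (const x) n
  ∑∑term-⇓ n = ⇓-resp (sym (evenFib-double-sum (const x) n))
    (∑≤-⇓-antidiag _ ℕ.≤-refl
      (λ i r i+r≡n → ∑≤-⇓-antidiag _ (≡.subst (r ≤_) i+r≡n (ℕ.m≤n+m r i))
        (λ j m j+m≡r → term-⇓ i j m i+r≡n j+m≡r)
        (λ j r<j → term-⇓0ʲ i j i+r≡n r<j))
      (λ i n<i → ∑≤-⇓0 (term n i) n λ j → term-⇓0ⁱ i j n<i))

-- The Fibonacci polynomials as tiling sums.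

module _ (a b : ℕ) where
  even-factor : ∀ n → (if does (2 ∣? suc n * 2) then a else b) ≡ a
  even-factor n =
    ≡.cong (if_then a else b) (dec-true (2 ∣? suc n * 2) (divides (suc n) ≡.refl))

  odd-factor : ∀ n → (if does (2 ∣? suc (suc n * 2)) then a else b) ≡ b
  odd-factor n = ≡.cong (if_then a else b) (dec-false (2 ∣? suc (suc n * 2)) 2∤1+2[1+n])
    where
    2∤1+2[1+n] : ¬ 2 ∣ suc (suc n * 2)
    2∤1+2[1+n] 2∣
      with () ← ∣1⇒≡1 (∣m+n∣m⇒∣n (≡.subst (2 ∣_) (ℕ.+-comm 1 (suc n * 2)) 2∣)
                                  (divides (suc n) ≡.refl))

  -- A mutual induction in which both sides obey the same recurrences: the `b` of an odd step meets
  -- the `a` in front of `evenFib` and forms `ab`. Indices are written `n * 2` because `suc n * 2`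
  -- computes to two successors, which lets `F` unfold.
  F-odd  : ∀ n → F a b (suc (n * 2)) ≈ᵖ oddFib (const (a * b)) n
  F-even : ∀ n → F a b (suc n * 2) ≈ᵖ const a *ᵖ evenFib (const (a * b)) n

  F-odd zero = sym (trans (*ᵖ-identityˡ (1ᵖ *ᵖ 1ᵖ)) (*ᵖ-identityˡ 1ᵖ))
  F-odd (suc n) = begin
    F a b (suc (suc n * 2))
      ≡⟨ ≡.cong (λ c → const c *ᵖ F a b (suc n * 2) +ᵖ y *ᵖ F a b (suc (n * 2)))
           (odd-factor n) ⟩
    const b *ᵖ F a b (suc n * 2) +ᵖ y *ᵖ F a b (suc (n * 2))
      ≈⟨ +ᵖ-cong (*-congˡᵖ {const b} (F-even n)) (*-congˡᵖ {y} (F-odd n)) ⟩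
    const b *ᵖ (const a *ᵖ E) +ᵖ y *ᵖ O
      ≈⟨ solve 5 (λ u v e y o → u :* (v :* e) :+ y :* o := (v :* u) :* e :+ y :* o) refl
           (const b) (const a) E y O ⟩
    const a *ᵖ const b *ᵖ E +ᵖ y *ᵖ O
      ≈⟨ +ᵖ-congʳ {y *ᵖ O} (*-congʳᵖ {E} (const-* a b)) ⟨
    const (a * b) *ᵖ E +ᵖ y *ᵖ O
      ≈⟨ oddFib-suc (const (a * b)) n ⟨
    oddFib (const (a * b)) (suc n) ∎
    where
    y = q ^ᵖ suc (n * 2)
    E = evenFib (const (a * b)) n
    O = oddFib (const (a * b)) n

  F-even zero = begin
    const a *ᵖ 1ᵖ +ᵖ 1ᵖ *ᵖ 0ᵖ
      ≈⟨ solve 1 (λ u → u :* con 1 :+ con 1 :* con 0 := u :* (con 1 :* (con 1 :* con 1)))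
           refl (const a) ⟩
    const a *ᵖ evenFib (const (a * b)) 0 ∎
  F-even (suc n) = begin
    F a b (suc (suc n) * 2)
      ≡⟨ ≡.cong (λ c → const c *ᵖ F a b (suc (suc n * 2)) +ᵖ y *ᵖ F a b (suc n * 2))
           (even-factor (suc n)) ⟩
    const a *ᵖ F a b (suc (suc n * 2)) +ᵖ y *ᵖ F a b (suc n * 2)
      ≈⟨ +ᵖ-cong (*-congˡᵖ {const a} (F-odd (suc n))) (*-congˡᵖ {y} (F-even n)) ⟩
    const a *ᵖ O +ᵖ y *ᵖ (const a *ᵖ E)
      ≈⟨ solve 4 (λ u o y e → u :* o :+ y :* (u :* e) := u :* (o :+ y :* e)) refl
           (const a) O y E ⟩
    const a *ᵖ (O +ᵖ y *ᵖ E)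
      ≈⟨ *-congˡᵖ {const a} (evenFib-suc (const (a * b)) n) ⟨
    const a *ᵖ evenFib (const (a * b)) (suc n) ∎
    where
    y = q ^ᵖ (suc n * 2)
    E = evenFib (const (a * b)) n
    O = oddFib (const (a * b)) (suc n)

theorem17 : (a b : ℕ) .{{_ : NonZero a}} .{{_ : NonZero b}} (n : ℕ) →
    let instance ab≢0 = m*n≢0 a b in
    ι (F a b (2 * n + 2)) ≃
      ι (const a) *ᶠ (∑[ i ≤ n ] ∑[ j ≤ n ]
        ((a * b) ^ᶻ ξ (+ n - + i - + j)
          *ᶠ ι (q ^ᵖ (i ^ 2 + (n + i + 1) * j))
          *ᶠ qbinom (n ∸ j) i *ᶠ qbinom (n ∸ i) j
          *ᶠ (a * b) ^ᶻ (+ 2 ℤ.* ⌊ + n - + i - + j /2⌋)))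
theorem17 a b n = ι-cong
  (trans (reflexive (≡.cong (F a b) (index n))) (F-even a b n))
  (⇓⇒≃ (⇓-* (⇓-ι (const a)) (∑∑term-⇓ (a * b) {{m*n≢0 a b}} n)))
  where
  index : ∀ n → 2 * n + 2 ≡ suc n * 2
  index = solve-∀
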